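{- Let $a,b$ be positive integers and let $p_{a\times b}$ be the $a\times b$ rectangular polyomino. Then the set $\mathcal{L}=\{p_{a\times b}\}$ is $n$-Noetherian for every $n\in\mathbb{N}$.
   Context: A polyomino is a region of $\mathbb{R}^2$ made of unit squares joined along coincident edges, considered up to translation; $p_{a\times b}$ is the rectangle of height $a$ and width $b$. $R_{n\times m}$ denotes the rectangular region of height $n$ and width $m$. A tiling of $R_{n\times m}$ by a multiset $T$ of polyominoes is a placement of all elements of $T$ in $R_{n\times m}$ covering every point, with no two different elements having two-dimensional overlap; a tiling by elements of $\mathcal{L}$ is a tiling by a multiset with elements drawn from $\mathcal{L}$. In this result all translations, reflections and rotations of the $a\times b$ polyomino are allowed. A rearrangement with rotations of a tiling of $R_{n\times m}$ by $T$ is any tiling of $R_{n\times m}$ by a multiset obtained from $T$ by replacing any of its elements by rotated copies (independently of each other). A tiling of $R_{n\times m}$ admits a subtiling allowing rotations if it has a rearrangement with rotations which is the side-by-side juxtaposition of a tiling of $R_{n\times m'}$ and a tiling of $R_{n\times m''}$ with $m=m'+m''$ and $m',m''\neq 0$. $\beta^R_n(\mathcal{L})$ is the smallest natural number such that every tiling of $R_{n\times m}$ by elements of $\mathcal{L}$ with $m>\beta^R_n(\mathcal{L})$ admits a subtiling allowing rotations; $\beta^R_n(\mathcal{L}):=\infty$ if there are tilings with $m$ arbitrarily large admitting no such subtiling. $\mathcal{L}$ is called $n$-Noetherian if $\beta^R_n(\mathcal{L})<\infty$. -}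

module Defs where

open import Data.Integer.Base as ℤ using (ℤ; +_; -_)
import Data.Integer.Properties as ℤ
open import Data.List.Base using (List; []; _∷_; _++_; map; upTo; cartesianProduct)
open import Data.List.Membership.Propositional using (_∈_)
open import Data.List.Membership.Propositional.Properties
  using (∈-map⁺; ∈-map⁻; ∈-upTo⁺; ∈-upTo⁻; ∈-cartesianProduct⁺; ∈-cartesianProduct⁻)
open import Data.List.Relation.Binary.BagAndSetEquality using (_∼[_]_; set)
open import Data.List.Relation.Binary.Disjoint.Propositional using (Disjoint)
open import Data.List.Relation.Binary.Permutation.Homogeneous using (Permutation)
open import Data.List.Relation.Binary.Subset.Propositional using (_⊆_)
open import Data.List.Relation.Unary.All using (All)
open import Data.List.Relation.Unary.AllPairs using (AllPairs)
open import Data.List.Relation.Unary.Any using (Any)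
open import Data.Nat.Base as ℕ using (ℕ; zero; suc; NonZero; _+_; _≤_; _<_)
open import Data.Nat.GeneralisedArithmetic using (fold)
import Data.Nat.Properties as ℕ
open import Data.Product.Base using (Σ; ∃; _×_; _,_; proj₁; proj₂)
open import Data.Sum.Base using (_⊎_)
open import Level using (0ℓ)
open import Relation.Binary.Construct.Closure.ReflexiveTransitive as Star using (Star; ε; _◅_; _◅◅_)
open import Relation.Binary.PropositionalEquality
open import Relation.Unary using (Pred)

-- (i , j) is the unit square in row i and column j; rows are counted along
-- the height and columns along the width.
Cell : Set
Cell = ℤ × ℤ

Adjacent : Cell → Cell → Set
Adjacent (i , j) (k , l) = ℤ.∣ i ℤ.- k ∣ + ℤ.∣ j ℤ.- l ∣ ≡ 1

Step : List Cell → Cell → Cell → Set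
Step cs c d = c ∈ cs × d ∈ cs × Adjacent c d

Connected : List Cell → Set
Connected cs = ∀ {c d} → c ∈ cs → d ∈ cs → Star (Step cs) c d

-- Only the set of cells matters, and only up to translation: see _≈_.
record Polyomino : Set where
  field
    cells     : List Cell
    nonempty  : ∃ (_∈ cells)
    connected : Connected cells

open Polyomino public

_+ᵥ_ : Cell → Cell → Cell
(i , j) +ᵥ (k , l) = i ℤ.+ k , j ℤ.+ l

_≈_ : Polyomino → Polyomino → Set
p ≈ q = Σ Cell λ v → map (v +ᵥ_) (cells p) ∼[ set ] cells q

mapPolyomino : (f : Cell → Cell) → (∀ c d → Adjacent c d → Adjacent (f c) (f d)) →
               Polyomino → Polyomino
mapPolyomino f f-adj p = record
  { cells     = map f (cells p)
  ; nonempty  = f (proj₁ (nonempty p)) , ∈-map⁺ f (proj₂ (nonempty p))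
  ; connected = conn
  }
  where
  conn : Connected (map f (cells p))
  conn c∈ d∈ with ∈-map⁻ f c∈ | ∈-map⁻ f d∈
  ... | _ , x∈ , refl | _ , y∈ , refl =
    Star.gmap f (λ (u∈ , v∈ , adj) → ∈-map⁺ f u∈ , ∈-map⁺ f v∈ , f-adj _ _ adj)
              (connected p x∈ y∈)

private
  ∣neg-neg∣ : ∀ i k → ℤ.∣ (- i) ℤ.- (- k) ∣ ≡ ℤ.∣ i ℤ.- k ∣
  ∣neg-neg∣ i k = trans (cong ℤ.∣_∣ (sym (ℤ.neg-distrib-+ i (- k)))) (ℤ.∣-i∣≡∣i∣ (i ℤ.- k))

rotateCell : Cell → Cell
rotateCell (i , j) = - j , i

reflectCell : Cell → Cell
reflectCell (i , j) = i , - j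

rotate : Polyomino → Polyomino
rotate = mapPolyomino rotateCell λ (i , j) (k , l) adj →
  trans (cong (_+ ℤ.∣ i ℤ.- k ∣) (∣neg-neg∣ j l))
        (trans (ℕ.+-comm ℤ.∣ j ℤ.- l ∣ ℤ.∣ i ℤ.- k ∣) adj)

reflect : Polyomino → Polyomino
reflect = mapPolyomino reflectCell λ (i , j) (k , l) adj →
  trans (cong (λ x → ℤ.∣ i ℤ.- k ∣ + x) (∣neg-neg∣ j l)) adj

RotatedCopy : Polyomino → Polyomino → Set
RotatedCopy p q = ∃ λ k → fold p rotate k ≈ q

Congruent : Polyomino → Polyomino → Set
Congruent p q = RotatedCopy p q ⊎ RotatedCopy (reflect p) q

Copies : Pred Polyomino 0ℓ → Pred Polyomino 0ℓ
Copies L q = ∃ λ p → L p × Congruent p q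

-- The region of height n and width m with a corner at the origin, possibly
-- empty.
R : ℕ → ℕ → List Cell
R n m = cartesianProduct (map +_ (upTo n)) (map +_ (upTo m))

private
  ∈-R⁺ : ∀ {n m i j} → i < n → j < m → (+ i , + j) ∈ R n m
  ∈-R⁺ i<n j<m = ∈-cartesianProduct⁺ (∈-map⁺ +_ (∈-upTo⁺ i<n)) (∈-map⁺ +_ (∈-upTo⁺ j<m))

  ∈-R⁻ : ∀ n m {c} → c ∈ R n m → ∃ λ i → ∃ λ j → i < n × j < m × c ≡ (+ i , + j)
  ∈-R⁻ n m c∈ with ∈-cartesianProduct⁻ (map +_ (upTo n)) (map +_ (upTo m)) c∈
  ... | i∈ , j∈ with ∈-map⁻ +_ i∈ | ∈-map⁻ +_ j∈
  ... | i , i∈′ , refl | j , j∈′ , refl = i , j , ∈-upTo⁻ i∈′ , ∈-upTo⁻ j∈′ , refl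

  ∣i-i∣ : ∀ i → ℤ.∣ i ℤ.- i ∣ ≡ 0
  ∣i-i∣ i = cong ℤ.∣_∣ (ℤ.+-inverseʳ i)

  ∣1+i-i∣ : ∀ i → ℤ.∣ + suc i ℤ.- + i ∣ ≡ 1
  ∣1+i-i∣ i = cong ℤ.∣_∣ (trans (ℤ.m-n≡m⊖n (suc i) i)
                          (trans (ℤ.⊖-≥ (ℕ.n≤1+n i)) (cong +_ (ℕ.m+n∸n≡m 1 i))))

  toOrigin : ∀ {n m} i j → i < n → j < m → Star (Step (R n m)) (+ i , + j) (+ 0 , + 0)
  toOrigin zero zero _ _ = ε
  toOrigin zero (suc j) i<n j<m =
    (∈-R⁺ i<n j<m , ∈-R⁺ i<n (ℕ.<⇒≤ j<m) , ∣1+i-i∣ j) ◅ toOrigin zero j i<n (ℕ.<⇒≤ j<m)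
  toOrigin (suc i) j i<n j<m =
    (∈-R⁺ i<n j<m , ∈-R⁺ (ℕ.<⇒≤ i<n) j<m , cong₂ _+_ (∣1+i-i∣ i) (∣i-i∣ (+ j)))
      ◅ toOrigin i j (ℕ.<⇒≤ i<n) j<m

  stepSym : ∀ {cs c d} → Step cs c d → Step cs d c
  stepSym {c = i , j} {k , l} (c∈ , d∈ , adj) =
    d∈ , c∈ , trans (cong₂ _+_ (ℤ.∣i-j∣≡∣j-i∣ k i) (ℤ.∣i-j∣≡∣j-i∣ l j)) adj

  R-connected : ∀ n m → Connected (R n m)
  R-connected n m c∈ d∈ with ∈-R⁻ n m c∈ | ∈-R⁻ n m d∈
  ... | i , j , i<n , j<m , refl | k , l , k<n , l<m , refl =
    toOrigin i j i<n j<m ◅◅ Star.reverse stepSym (toOrigin k l k<n l<m)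

rectangle : (a b : ℕ) .{{_ : NonZero a}} .{{_ : NonZero b}} → Polyomino
rectangle a b = record
  { cells     = R a b
  ; nonempty  = (+ 0 , + 0) , ∈-R⁺ (ℕ.>-nonZero⁻¹ a) (ℕ.>-nonZero⁻¹ b)
  ; connected = R-connected a b
  }

-- Integer translations lose nothing: pieces made of unit squares that tile
-- R n m exactly are forced onto the integer grid.
Placement : Set
Placement = Polyomino × Cell

footprint : Placement → List Cell
footprint (p , v) = map (v +ᵥ_) (cells p)

shapes : List Placement → List Polyomino
shapes = map proj₁

-- τ is a tiling by the multiset shapes τ; the order of the list is irrelevant.
record IsTiling (n m : ℕ) (τ : List Placement) : Set where
  field
    inside     : All (λ t → footprint t ⊆ R n m) τ
    covers     : ∀ {c} → c ∈ R n m → Any (λ t → c ∈ footprint t) τ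
    nonoverlap : AllPairs (λ s t → Disjoint (footprint s) (footprint t)) τ

-- RotatedCopy is an equivalence relation, so Permutation RotatedCopy matches
-- the two multisets bijectively, each polyomino with a rotated copy of itself.
record IsRearrangement (n m : ℕ) (τ τ′ : List Placement) : Set where
  field
    isTiling : IsTiling n m τ′
    rotated  : Permutation RotatedCopy (shapes τ) (shapes τ′)

shiftRight : ℕ → Placement → Placement
shiftRight d (p , v) = p , (+ 0 , + d) +ᵥ v

juxtapose : ℕ → List Placement → List Placement → List Placement
juxtapose m′ τ₁ τ₂ = τ₁ ++ map (shiftRight m′) τ₂

record AdmitsSubtiling (n m : ℕ) (τ : List Placement) : Set where
  field
    m′ m″         : ℕ
    m≡m′+m″       : m ≡ m′ + m″
    m′≢0          : m′ ≢ 0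
    m″≢0          : m″ ≢ 0
    τ₁ τ₂         : List Placement
    tiling₁       : IsTiling n m′ τ₁
    tiling₂       : IsTiling n m″ τ₂
    rearrangement : IsRearrangement n m τ (juxtapose m′ τ₁ τ₂)

SubtilingsBeyond : ℕ → Pred Polyomino 0ℓ → ℕ → Set
SubtilingsBeyond n L β =
  ∀ m → β < m → ∀ τ → IsTiling n m τ → All L (shapes τ) → AdmitsSubtiling n m τ

-- β is the finite value of βᴿₙ(L).
record Isβᴿ (n : ℕ) (L : Pred Polyomino 0ℓ) (β : ℕ) : Set where
  field
    bound : SubtilingsBeyond n L β
    least : ∀ k → SubtilingsBeyond n L k → β ≤ k

-- Existence of a finite value is βᴿₙ(L) < ∞.
Noetherian : ℕ → Pred Polyomino 0ℓ → Set
Noetherian n L = ∃ (Isβᴿ n L)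

module Submission where

-- For functions F and G on ℤ, the weight (F (x + h) − F x) (G (y + w) − G y)
-- of the h × w box with corner (x , y) is a sum of weights of unit cells, so it
-- is additive over tilings. Three choices constrain a tiling of R n m:
--   * F = G = id counts the tiles: any two tilings use equally many, hence they
--     are rearrangements of each other;
--   * F = G = indicator of d ∣ z, with d = a or d = b, kills every tile, so d
--     divides n or m;
--   * F = indicator of z > 0, G = id measures the first row, so m is a sum of
--     a's and b's (likewise n, by the first column).
-- Conversely these conditions suffice to tile by grids and strips. They are
-- decidable, and for m > a b they allow a strip of width a, b or a b to be split
-- off. The least bound is then found by searching downwards from a b.

open import Defs
open import Algebra.Properties.AbelianGroup using (∙-cancelˡ)
open import Data.Bool.Base using (if_then_else_)
open import Data.Empty using (⊥)
open import Data.Integer.Base as ℤ using (ℤ; +_; -[1+_]; -_; 0ℤ; 1ℤ)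
import Data.Integer.Divisibility.Signed as ℤ
import Data.Integer.Properties as ℤ
import Data.Integer.Tactic.RingSolver as ℤ
open import Data.List.Base
open import Data.List.Membership.Propositional using (_∈_)
open import Data.List.Membership.Propositional.Properties
open import Data.List.Membership.Propositional.Properties.WithK using (unique∧set⇒bag)
open import Data.List.Properties using (map-∘; map-cong; map-id; map-++; length-map; upTo-∷ʳ)
open import Data.List.Relation.Binary.BagAndSetEquality as BagSet using (_∼[_]_; set; ∼bag⇒↭)
open import Data.List.Relation.Binary.Disjoint.Propositional using (Disjoint)
open import Data.List.Relation.Binary.Permutation.Homogeneous as Homogeneous using (Permutation)
open import Data.List.Relation.Binary.Permutation.Propositional as Perm using (_↭_)
open import Data.List.Relation.Binary.Pointwise.Base using (Pointwise; []; _∷_)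
open import Data.List.Relation.Binary.Subset.Propositional using (_⊆_)
open import Data.List.Relation.Unary.All as All using (All; []; _∷_)
import Data.List.Relation.Unary.All.Properties as All
open import Data.List.Relation.Unary.AllPairs as AllPairs using (AllPairs; []; _∷_)
import Data.List.Relation.Unary.AllPairs.Properties as AllPairs
open import Data.List.Relation.Unary.Any as Any using (Any; here)
import Data.List.Relation.Unary.Any.Properties as Any
open import Data.List.Relation.Unary.Unique.Propositional using (Unique)
import Data.List.Relation.Unary.Unique.Propositional.Properties as Unique
open import Data.Nat.Base as ℕ using (ℕ; zero; suc; NonZero; _<_; _≤_; _+_; _*_; _∸_)
open import Data.Nat.Divisibility as ℕ using (_∣_; _∣?_)
open import Data.Nat.GeneralisedArithmetic using (fold)
import Data.Nat.Properties as ℕ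
import Data.Nat.Tactic.RingSolver as ℕ
open import Data.Product.Base using (∃; ∃₂; _×_; _,_; proj₁; proj₂)
open import Data.Sum.Base as Sum using (_⊎_; inj₁; inj₂; [_,_]′)
open import Function.Base using (_∘_; id)
open import Function.Bundles using (mk⇔; Equivalence)
import Function.Properties.Equivalence as ⇔
open import Relation.Binary.PropositionalEquality
open import Relation.Nullary using (Dec; yes; no; does; contradiction)
open import Relation.Nullary.Decidable using (map′; _×-dec_; _⊎-dec_; _→-dec_; ¬?)
open import Relation.Unary using (Decidable; ｛_｝)

-- Translations and equivalence of polyominoes.

translate : Cell → List Cell → List Cell
translate v = map (v +ᵥ_)

0ᵥ : Cell
0ᵥ = 0ℤ , 0ℤ

-ᵥ_ : Cell → Cell
-ᵥ (i , j) = - i , - j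

+ᵥ-assoc : ∀ u v w → (u +ᵥ v) +ᵥ w ≡ u +ᵥ (v +ᵥ w)
+ᵥ-assoc (i , j) (k , l) (m , n) = cong₂ _,_ (ℤ.+-assoc i k m) (ℤ.+-assoc j l n)

+ᵥ-identityˡ : ∀ v → 0ᵥ +ᵥ v ≡ v
+ᵥ-identityˡ (i , j) = cong₂ _,_ (ℤ.+-identityˡ i) (ℤ.+-identityˡ j)

+ᵥ-inverseˡ : ∀ v → (-ᵥ v) +ᵥ v ≡ 0ᵥ
+ᵥ-inverseˡ (i , j) = cong₂ _,_ (ℤ.+-inverseˡ i) (ℤ.+-inverseˡ j)

+ᵥ-cancelˡ : ∀ u {v w} → u +ᵥ v ≡ u +ᵥ w → v ≡ w
+ᵥ-cancelˡ (i , j) eq = cong₂ _,_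
  (∙-cancelˡ ℤ.+-0-abelianGroup i _ _ (cong proj₁ eq))
  (∙-cancelˡ ℤ.+-0-abelianGroup j _ _ (cong proj₂ eq))

translate-translate : ∀ u v cs → translate u (translate v cs) ≡ translate (u +ᵥ v) cs
translate-translate u v cs =
  trans (sym (map-∘ cs)) (map-cong (λ c → sym (+ᵥ-assoc u v c)) cs)

translate-0 : ∀ cs → translate 0ᵥ cs ≡ cs
translate-0 cs = trans (map-cong +ᵥ-identityˡ cs) (map-id cs)

∼-reflexive : {cs ds : List Cell} → cs ≡ ds → cs ∼[ set ] ds
∼-reflexive refl = ⇔.refl

translate-cong : ∀ v {cs ds} → cs ∼[ set ] ds → translate v cs ∼[ set ] translate v ds
translate-cong v cs∼ds = BagSet.map-cong (λ _ → refl) cs∼ds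

≈-refl : ∀ p → p ≈ p
≈-refl p = 0ᵥ , ∼-reflexive (translate-0 (cells p))

≈-sym : ∀ p q → p ≈ q → q ≈ p
≈-sym p q (v , e) = -ᵥ v ,
  ⇔.trans (translate-cong (-ᵥ v) (⇔.sym e))
    (∼-reflexive (trans (translate-translate (-ᵥ v) v (cells p))
                 (trans (cong (λ u → translate u (cells p)) (+ᵥ-inverseˡ v)) (translate-0 (cells p)))))

≈-trans : ∀ p q r → p ≈ q → q ≈ r → p ≈ r
≈-trans p q r (v , e) (u , f) = u +ᵥ v ,
  ⇔.trans (∼-reflexive (sym (translate-translate u v (cells p)))) (⇔.trans (translate-cong u e) f)

-- Rotation is linear, so it turns a translation by `v` into a translation by `rotateCell v`.
rotate-cong : ∀ p q → p ≈ q → rotate p ≈ rotate q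
rotate-cong p q (v@(i , j) , e) = rotateCell v ,
  ⇔.trans (∼-reflexive rotate-translate) (BagSet.map-cong (λ _ → refl) e)
  where
  rotate-translate : translate (rotateCell v) (map rotateCell (cells p)) ≡
                     map rotateCell (translate v (cells p))
  rotate-translate = trans (sym (map-∘ (cells p)))
    (trans (map-cong (λ (k , l) → cong (_, i ℤ.+ k) (sym (ℤ.neg-distrib-+ j l))) (cells p)) (map-∘ (cells p)))

-- Symmetries of rectangles.

∈-R⁺ : ∀ {n m i j} → i < n → j < m → (+ i , + j) ∈ R n m
∈-R⁺ i<n j<m = ∈-cartesianProduct⁺ (∈-map⁺ +_ (∈-upTo⁺ i<n)) (∈-map⁺ +_ (∈-upTo⁺ j<m))

∈-R⁻ : ∀ n m {c} → c ∈ R n m → ∃₂ λ i j → i < n × j < m × c ≡ (+ i , + j)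
∈-R⁻ n m c∈ with ∈-cartesianProduct⁻ (map +_ (upTo n)) (map +_ (upTo m)) c∈
... | i∈ , j∈ with ∈-map⁻ +_ i∈ | ∈-map⁻ +_ j∈
... | i , i∈upTo , refl | j , j∈upTo , refl = i , j , ∈-upTo⁻ i∈upTo , ∈-upTo⁻ j∈upTo , refl

-- Under negation, [0, w) becomes its own translate by 1 - w.
mirror : ∀ {w k} → k < w → ∃ λ l → l < w × - (+ k) ≡ (1ℤ ℤ.- + w) ℤ.+ + l × (1ℤ ℤ.- + w) ℤ.+ + k ≡ - (+ l)
mirror {k = k} k<w with ℕ.m≤n⇒∃[o]m+o≡n k<w
... | l , refl = l , ℕ.s≤s (ℕ.m≤n+m l k) , neg (+ k) (+ l) , neg′ (+ k) (+ l)
  where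
  neg : ∀ x y → - x ≡ (1ℤ ℤ.- (1ℤ ℤ.+ (x ℤ.+ y))) ℤ.+ y
  neg = ℤ.solve-∀
  neg′ : ∀ x y → (1ℤ ℤ.- (1ℤ ℤ.+ (x ℤ.+ y))) ℤ.+ x ≡ - y
  neg′ = ℤ.solve-∀

module _ (h w : ℕ) .{{_ : NonZero h}} .{{_ : NonZero w}} where

  -- A quarter turn sends `(i , k)` to `(- k , i)`. The negated columns become the rows, and by
  -- `mirror` they fill the translate of `[0, w)` by `1 - w`.
  rotate-rectangle : rotate (rectangle h w) ≈ rectangle w h
  rotate-rectangle = ≈-sym (rectangle w h) (rotate (rectangle h w)) ((1ℤ ℤ.- + w , 0ℤ) , mk⇔ to from)
    where
    to : ∀ {c} → c ∈ translate (1ℤ ℤ.- + w , 0ℤ) (R w h) → c ∈ map rotateCell (R h w)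
    to c∈ with ∈-map⁻ _ c∈
    ... | _ , d∈ , refl with ∈-R⁻ w h d∈
    ... | k , i , k<w , i<h , refl with mirror k<w
    ... | l , l<w , _ , eq =
      subst (_∈ map rotateCell (R h w)) (sym (cong₂ _,_ eq (ℤ.+-identityˡ (+ i))))
        (∈-map⁺ rotateCell (∈-R⁺ i<h l<w))
    from : ∀ {c} → c ∈ map rotateCell (R h w) → c ∈ translate (1ℤ ℤ.- + w , 0ℤ) (R w h)
    from c∈ with ∈-map⁻ _ c∈
    ... | _ , d∈ , refl with ∈-R⁻ h w d∈
    ... | i , k , i<h , k<w , refl with mirror k<w
    ... | l , l<w , eq , _ =
      subst (_∈ translate (1ℤ ℤ.- + w , 0ℤ) (R w h)) (sym (cong₂ _,_ eq (sym (ℤ.+-identityˡ (+ i)))))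
        (∈-map⁺ _ (∈-R⁺ l<w i<h))

  reflect-rectangle : reflect (rectangle h w) ≈ rectangle h w
  reflect-rectangle = ≈-sym (rectangle h w) (reflect (rectangle h w)) ((0ℤ , 1ℤ ℤ.- + w) , mk⇔ to from)
    where
    to : ∀ {c} → c ∈ translate (0ℤ , 1ℤ ℤ.- + w) (R h w) → c ∈ map reflectCell (R h w)
    to c∈ with ∈-map⁻ _ c∈
    ... | _ , d∈ , refl with ∈-R⁻ h w d∈
    ... | i , k , i<h , k<w , refl with mirror k<w
    ... | l , l<w , _ , eq =
      subst (_∈ map reflectCell (R h w)) (sym (cong₂ _,_ (ℤ.+-identityˡ (+ i)) eq))
        (∈-map⁺ reflectCell (∈-R⁺ i<h l<w))
    from : ∀ {c} → c ∈ map reflectCell (R h w) → c ∈ translate (0ℤ , 1ℤ ℤ.- + w) (R h w)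
    from c∈ with ∈-map⁻ _ c∈
    ... | _ , d∈ , refl with ∈-R⁻ h w d∈
    ... | i , k , i<h , k<w , refl with mirror k<w
    ... | l , l<w , eq , _ =
      subst (_∈ translate (0ℤ , 1ℤ ℤ.- + w) (R h w)) (sym (cong₂ _,_ (sym (ℤ.+-identityˡ (+ i))) eq))
        (∈-map⁺ _ (∈-R⁺ i<h l<w))

-- Finite sums of integers.

∑ : {A : Set} → (A → ℤ) → List A → ℤ
∑ f []       = 0ℤ
∑ f (x ∷ xs) = f x ℤ.+ ∑ f xs

private variable
  A B : Set

∑-cong : {f g : A → ℤ} → (∀ x → f x ≡ g x) → ∀ xs → ∑ f xs ≡ ∑ g xs
∑-cong f≗g []       = refl
∑-cong f≗g (x ∷ xs) = cong₂ ℤ._+_ (f≗g x) (∑-cong f≗g xs)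

∑-map : ∀ (f : B → ℤ) (g : A → B) xs → ∑ f (map g xs) ≡ ∑ (f ∘ g) xs
∑-map f g []       = refl
∑-map f g (x ∷ xs) = cong (ℤ._+_ (f (g x))) (∑-map f g xs)

∑-++ : ∀ (f : A → ℤ) xs ys → ∑ f (xs ++ ys) ≡ ∑ f xs ℤ.+ ∑ f ys
∑-++ f []       ys = sym (ℤ.+-identityˡ _)
∑-++ f (x ∷ xs) ys = trans (cong (ℤ._+_ (f x)) (∑-++ f xs ys)) (sym (ℤ.+-assoc (f x) _ _))

exchange : ∀ i j k → i ℤ.+ (j ℤ.+ k) ≡ j ℤ.+ (i ℤ.+ k)
exchange = ℤ.solve-∀

∑-↭ : ∀ (f : A → ℤ) {xs ys} → xs ↭ ys → ∑ f xs ≡ ∑ f ys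
∑-↭ f Perm.refl          = refl
∑-↭ f (Perm.prep x p)    = cong (ℤ._+_ (f x)) (∑-↭ f p)
∑-↭ f (Perm.swap x y p) rewrite ∑-↭ f p = exchange (f x) (f y) _
∑-↭ f (Perm.trans p q)   = trans (∑-↭ f p) (∑-↭ f q)

∑-concatMap : ∀ (f : B → ℤ) (g : A → List B) xs → ∑ f (concatMap g xs) ≡ ∑ (∑ f ∘ g) xs
∑-concatMap f g []       = refl
∑-concatMap f g (x ∷ xs) = trans (∑-++ f (g x) _) (cong (ℤ._+_ (∑ f (g x))) (∑-concatMap f g xs))

*-distribˡ-∑ : ∀ k (f : A → ℤ) xs → k ℤ.* ∑ f xs ≡ ∑ (λ x → k ℤ.* f x) xs
*-distribˡ-∑ k f []       = ℤ.*-zeroʳ k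
*-distribˡ-∑ k f (x ∷ xs) = trans (ℤ.*-distribˡ-+ k (f x) _) (cong (ℤ._+_ (k ℤ.* f x)) (*-distribˡ-∑ k f xs))

∑-cartesianProduct : ∀ (f : A → ℤ) (g : B → ℤ) xs ys →
  ∑ (λ (x , y) → f x ℤ.* g y) (cartesianProduct xs ys) ≡ ∑ f xs ℤ.* ∑ g ys
∑-cartesianProduct f g []       ys = refl
∑-cartesianProduct {A} {B} f g (x ∷ xs) ys = begin
  ∑ fg (map (x ,_) ys ++ cartesianProduct xs ys)         ≡⟨ ∑-++ fg (map (x ,_) ys) _ ⟩
  ∑ fg (map (x ,_) ys) ℤ.+ ∑ fg (cartesianProduct xs ys) ≡⟨ cong₂ ℤ._+_ row (∑-cartesianProduct f g xs ys) ⟩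
  f x ℤ.* ∑ g ys ℤ.+ ∑ f xs ℤ.* ∑ g ys                   ≡⟨ ℤ.*-distribʳ-+ (∑ g ys) (f x) (∑ f xs) ⟨
  (f x ℤ.+ ∑ f xs) ℤ.* ∑ g ys                            ∎
  where
  open ≡-Reasoning
  fg : A × B → ℤ
  fg (x , y) = f x ℤ.* g y
  row : ∑ fg (map (x ,_) ys) ≡ f x ℤ.* ∑ g ys
  row = trans (∑-map fg (x ,_) ys) (sym (*-distribˡ-∑ (f x) g ys))

∑-zero : {f : A → ℤ} → (∀ x → f x ≡ 0ℤ) → ∀ xs → ∑ f xs ≡ 0ℤ
∑-zero f≡0 []       = refl
∑-zero f≡0 (x ∷ xs) = cong₂ ℤ._+_ (f≡0 x) (∑-zero f≡0 xs)

∑-const : ∀ {f : A → ℤ} {k} → (∀ x → f x ≡ + k) → ∀ xs → ∑ f xs ≡ + (length xs * k)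
∑-const f≡k []       = refl
∑-const f≡k (x ∷ xs) = cong₂ ℤ._+_ (f≡k x) (∑-const f≡k xs)

-- Weights of boxes.

increment : (ℤ → ℤ) → ℤ → ℤ
increment F z = F (1ℤ ℤ.+ z) ℤ.- F z

∑-telescope : ∀ (F : ℤ → ℤ) x h → ∑ (λ k → increment F (x ℤ.+ + k)) (upTo h) ≡ F (x ℤ.+ + h) ℤ.- F x
∑-telescope F x zero rewrite ℤ.+-identityʳ x = sym (ℤ.+-inverseʳ (F x))
∑-telescope F x (suc h) = begin
  ∑ f (upTo (suc h))                             ≡⟨ cong (∑ f) (upTo-∷ʳ h) ⟨
  ∑ f (upTo h ∷ʳ h)                              ≡⟨ ∑-++ f (upTo h) (h ∷ []) ⟩
  ∑ f (upTo h) ℤ.+ (f h ℤ.+ 0ℤ)                  ≡⟨ cong₂ ℤ._+_ (∑-telescope F x h) (ℤ.+-identityʳ (f h)) ⟩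
  (F x+h ℤ.- F x) ℤ.+ (F (1ℤ ℤ.+ x+h) ℤ.- F x+h) ≡⟨ collapse (F x+h) (F x) (F (1ℤ ℤ.+ x+h)) ⟩
  F (1ℤ ℤ.+ x+h) ℤ.- F x                         ≡⟨ cong (λ z → F z ℤ.- F x) (exchange 1ℤ x (+ h)) ⟩
  F (x ℤ.+ + suc h) ℤ.- F x                      ∎
  where
  open ≡-Reasoning
  x+h = x ℤ.+ + h
  f = λ k → increment F (x ℤ.+ + k)
  collapse : ∀ i j k → (i ℤ.- j) ℤ.+ (k ℤ.- i) ≡ k ℤ.- j
  collapse = ℤ.solve-∀

boxMeasure : (F G : ℤ → ℤ) → Cell → ℕ → ℕ → ℤ
boxMeasure F G (x , y) h w = (F (x ℤ.+ + h) ℤ.- F x) ℤ.* (G (y ℤ.+ + w) ℤ.- G y)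

-- The weight of a cell is a function of its row times a function of its column, so the sum factors
-- into two sums, each of which telescopes.
∑-box : ∀ (F G : ℤ → ℤ) v h w →
  ∑ (λ (i , j) → increment F i ℤ.* increment G j) (translate v (R h w)) ≡ boxMeasure F G v h w
∑-box F G v@(x , y) h w = begin
  ∑ _ (translate v (R h w))
    ≡⟨ ∑-map _ (v +ᵥ_) (R h w) ⟩
  ∑ (λ (i , j) → f i ℤ.* g j) (R h w)
    ≡⟨ ∑-cartesianProduct f g (map +_ (upTo h)) (map +_ (upTo w)) ⟩
  ∑ f (map +_ (upTo h)) ℤ.* ∑ g (map +_ (upTo w))
    ≡⟨ cong₂ ℤ._*_ (trans (∑-map f +_ (upTo h)) (∑-telescope F x h))
                   (trans (∑-map g +_ (upTo w)) (∑-telescope G y w)) ⟩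
  boxMeasure F G v h w ∎
  where
  open ≡-Reasoning
  f = λ i → increment F (x ℤ.+ i)
  g = λ j → increment G (y ℤ.+ j)

R-unique : ∀ n m → Unique (R n m)
R-unique n m = Unique.cartesianProduct⁺
  (Unique.map⁺ ℤ.+-injective (Unique.upTo⁺ n))
  (Unique.map⁺ ℤ.+-injective (Unique.upTo⁺ m))

-- Functions detecting divisibility and the first row.

module _ (d : ℕ) where

  multipleOf : ℤ → ℤ
  multipleOf z = if does (d ∣? ℤ.∣ z ∣) then 1ℤ else 0ℤ

  -- This periodicity kills the factor of `boxMeasure` that belongs to a side divisible by `d`.
  multipleOf-+ : ∀ z {h} → d ∣ h → multipleOf (z ℤ.+ + h) ≡ multipleOf z
  multipleOf-+ z {h} d∣h with d ∣? ℤ.∣ z ℤ.+ + h ∣ | d ∣? ℤ.∣ z ∣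
  ... | yes _     | yes _   = refl
  ... | no _      | no _    = refl
  ... | yes d∣z+h | no d∤z  =
    contradiction (ℤ.∣⇒∣ᵤ {+ d} (ℤ.∣m+n∣n⇒∣m {m = z} (ℤ.∣ᵤ⇒∣ d∣z+h) (ℤ.∣ᵤ⇒∣ d∣h))) d∤z
  ... | no d∤z+h  | yes d∣z =
    contradiction (ℤ.∣⇒∣ᵤ {+ d} (ℤ.∣m∣n⇒∣m+n {m = z} (ℤ.∣ᵤ⇒∣ d∣z) (ℤ.∣ᵤ⇒∣ d∣h))) d∤z+h

  -- Since `d` divides 0, the indicator is 1 at the origin; equality with its value at `+ n` makes
  -- that value 1 too.
  multipleOf-∣ : ∀ {n} → multipleOf (+ n) ℤ.- multipleOf 0ℤ ≡ 0ℤ → d ∣ n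
  multipleOf-∣ {n} eq with d ∣? n | d ∣? 0
  ... | yes d∣n | _      = d∣n
  ... | no _    | no d∤0 = contradiction (d ℕ.∣0) d∤0
  multipleOf-∣ () | no _ | yes _

-- Its increment is 1 at 0 and vanishes elsewhere, so a weight built with it sees only row 0, or
-- only column 0.
step : ℤ → ℤ
step (+ suc _) = 1ℤ
step _         = 0ℤ

step-nonneg : ∀ z → ∃ λ k → step z ≡ + k
step-nonneg (+ suc _) = 1 , refl
step-nonneg (+ zero)  = 0 , refl
step-nonneg -[1+ _ ]  = 0 , refl

-- Monotonicity is recorded with a natural number because that number becomes a coefficient in
-- `Representable`, where negative ones are excluded.
step-mono : ∀ z h → ∃ λ k → step (z ℤ.+ + h) ℤ.- step z ≡ + k
step-mono (+ suc _) h = 0 , refl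
step-mono (+ zero)  h with step-nonneg (+ h)
... | k , eq = k , trans (ℤ.+-identityʳ _) eq
step-mono -[1+ n ]  h with step-nonneg (-[1+ n ] ℤ.+ + h)
... | k , eq = k , trans (ℤ.+-identityʳ _) eq

width : ∀ y w → (y ℤ.+ w) ℤ.- y ≡ w
width = ℤ.solve-∀

-- Gluing tilings.

shift : Cell → Placement → Placement
shift v (p , u) = p , v +ᵥ u

shapes-++-shift : ∀ v τ₁ τ₂ → shapes (τ₁ ++ map (shift v) τ₂) ≡ shapes τ₁ ++ shapes τ₂
shapes-++-shift v τ₁ τ₂ = trans (map-++ proj₁ τ₁ (map (shift v) τ₂)) (cong (shapes τ₁ ++_) (sym (map-∘ τ₂)))

footprint-shift : ∀ v t → footprint (shift v t) ≡ translate v (footprint t)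
footprint-shift v (p , u) = sym (translate-translate v u (cells p))

-- Horizontal and vertical gluing are one construction: the hypotheses say that a rectangle and a
-- translate of another one partition `R n m`. Pieces from different sides are then disjoint because
-- the regions around them are.
module Cut {n m n₁ m₁ n₂ m₂} (v : Cell)
  (left⊆ : R n₁ m₁ ⊆ R n m) (right⊆ : translate v (R n₂ m₂) ⊆ R n m)
  (cut : ∀ {c} → c ∈ R n m → c ∈ R n₁ m₁ ⊎ c ∈ translate v (R n₂ m₂))
  (disjoint : Disjoint (R n₁ m₁) (translate v (R n₂ m₂))) where

  shift-⊆ : ∀ {t} {cs} → footprint t ⊆ cs → footprint (shift v t) ⊆ translate v cs
  shift-⊆ {t} t⊆ c∈ with ∈-map⁻ (v +ᵥ_) (subst (_ ∈_) (footprint-shift v t) c∈)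
  ... | d , d∈ , refl = ∈-map⁺ (v +ᵥ_) (t⊆ d∈)

  shift-disjoint : ∀ {s t} → Disjoint (footprint s) (footprint t) →
                   Disjoint (footprint (shift v s)) (footprint (shift v t))
  shift-disjoint {s} {t} s#t (c∈s , c∈t)
    with ∈-map⁻ (v +ᵥ_) (subst (_ ∈_) (footprint-shift v s) c∈s)
       | ∈-map⁻ (v +ᵥ_) (subst (_ ∈_) (footprint-shift v t) c∈t)
  ... | d , d∈s , refl | e , e∈t , eq = s#t (d∈s , subst (_∈ footprint t) (sym (+ᵥ-cancelˡ v eq)) e∈t)

  glue : ∀ {τ₁ τ₂} → IsTiling n₁ m₁ τ₁ → IsTiling n₂ m₂ τ₂ → IsTiling n m (τ₁ ++ map (shift v) τ₂)
  glue {τ₁} {τ₂} t₁ t₂ = record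
    { inside     = All.++⁺ (All.map (λ {s} → inside₁ {s}) T₁.inside)
                           (All.map⁺ (All.map (λ {t} → inside₂ {t}) T₂.inside))
    ; covers     = λ c∈ → [ Any.++⁺ˡ ∘ T₁.covers , Any.++⁺ʳ τ₁ ∘ covers₂ ]′ (cut c∈)
    ; nonoverlap = AllPairs.++⁺ T₁.nonoverlap
                     (AllPairs.map⁺ (AllPairs.map (λ {s} {t} → shift-disjoint {s} {t}) T₂.nonoverlap))
                     (All.map (λ {s} → across {s}) T₁.inside)
    }
    where
    module T₁ = IsTiling t₁
    module T₂ = IsTiling t₂
    inside₁ : ∀ {s} → footprint s ⊆ R n₁ m₁ → footprint s ⊆ R n m
    inside₁ s⊆ c∈ = left⊆ (s⊆ c∈)
    inside₂ : ∀ {t} → footprint t ⊆ R n₂ m₂ → footprint (shift v t) ⊆ R n m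
    inside₂ {t} t⊆ c∈ = right⊆ (shift-⊆ {t} t⊆ c∈)
    across : ∀ {s} → footprint s ⊆ R n₁ m₁ →
             All (λ t → Disjoint (footprint s) (footprint t)) (map (shift v) τ₂)
    across s⊆ = All.map⁺ (All.map
      (λ {t} (t⊆ : footprint t ⊆ R n₂ m₂) {_} (c∈s , c∈t) → disjoint (s⊆ c∈s , shift-⊆ {t} t⊆ c∈t))
      T₂.inside)
    covers₂ : ∀ {c} → c ∈ translate v (R n₂ m₂) → Any (λ t → c ∈ footprint t) (map (shift v) τ₂)
    covers₂ c∈ with ∈-map⁻ (v +ᵥ_) c∈
    ... | d , d∈ , refl = Any.map⁺ (Any.map
      (λ {t} d∈t → subst (_ ∈_) (sym (footprint-shift v t)) (∈-map⁺ (v +ᵥ_) d∈t)) (T₂.covers d∈))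

-- Decides on which side of the cut at `k` a coordinate lies; beyond the cut, `o` is the coordinate
-- in the unshifted second piece.
<⊎≥ : ∀ i k {l} → i < k + l → i < k ⊎ ∃ λ o → o < l × k + o ≡ i
<⊎≥ i k i<k+l with i ℕ.<? k
... | yes i<k = inj₁ i<k
... | no  i≮k with ℕ.m≤n⇒∃[o]m+o≡n (ℕ.≮⇒≥ i≮k)
... | o , refl = inj₂ (o , ℕ.+-cancelˡ-< k o _ i<k+l , refl)

-- `shiftRight m₁` unfolds to `shift (+ 0 , + m₁)`, so `glue` yields `juxtapose` as it stands.
juxtapose-tiling : ∀ {n m₁ m₂ τ₁ τ₂} → IsTiling n m₁ τ₁ → IsTiling n m₂ τ₂ →
                   IsTiling n (m₁ + m₂) (juxtapose m₁ τ₁ τ₂)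
juxtapose-tiling {n} {m₁} {m₂} = Cut.glue (+ 0 , + m₁) left⊆ right⊆ cut disjoint
  where
  left⊆ : R n m₁ ⊆ R n (m₁ + m₂)
  left⊆ c∈ with ∈-R⁻ n m₁ c∈
  ... | i , j , i< , j< , refl = ∈-R⁺ i< (ℕ.<-≤-trans j< (ℕ.m≤m+n m₁ m₂))
  right⊆ : translate (+ 0 , + m₁) (R n m₂) ⊆ R n (m₁ + m₂)
  right⊆ c∈ with ∈-map⁻ _ c∈
  ... | _ , d∈ , refl with ∈-R⁻ n m₂ d∈
  ... | i , j , i< , j< , refl = ∈-R⁺ i< (ℕ.+-monoʳ-< m₁ j<)
  cut : ∀ {c} → c ∈ R n (m₁ + m₂) → c ∈ R n m₁ ⊎ c ∈ translate (+ 0 , + m₁) (R n m₂)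
  cut c∈ with ∈-R⁻ n (m₁ + m₂) c∈
  ... | i , j , i< , j< , refl with <⊎≥ j m₁ j<
  ... | inj₁ j<m₁           = inj₁ (∈-R⁺ i< j<m₁)
  ... | inj₂ (o , o< , refl) = inj₂ (∈-map⁺ _ (∈-R⁺ i< o<))
  disjoint : Disjoint (R n m₁) (translate (+ 0 , + m₁) (R n m₂))
  disjoint (c∈l , c∈r) with ∈-map⁻ _ c∈r
  ... | _ , d∈ , refl with ∈-R⁻ n m₂ d∈
  ... | i , j , i< , j< , refl with ∈-R⁻ n m₁ c∈l
  ... | _ , _ , _ , j<m₁ , refl = ℕ.m+n≮m m₁ j j<m₁

stack-tiling : ∀ {n₁ n₂ m τ₁ τ₂} → IsTiling n₁ m τ₁ → IsTiling n₂ m τ₂ →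
               IsTiling (n₁ + n₂) m (τ₁ ++ map (shift (+ n₁ , + 0)) τ₂)
stack-tiling {n₁} {n₂} {m} = Cut.glue (+ n₁ , + 0) top⊆ bottom⊆ cut disjoint
  where
  top⊆ : R n₁ m ⊆ R (n₁ + n₂) m
  top⊆ c∈ with ∈-R⁻ n₁ m c∈
  ... | i , j , i< , j< , refl = ∈-R⁺ (ℕ.<-≤-trans i< (ℕ.m≤m+n n₁ n₂)) j<
  bottom⊆ : translate (+ n₁ , + 0) (R n₂ m) ⊆ R (n₁ + n₂) m
  bottom⊆ c∈ with ∈-map⁻ _ c∈
  ... | _ , d∈ , refl with ∈-R⁻ n₂ m d∈
  ... | i , j , i< , j< , refl = ∈-R⁺ (ℕ.+-monoʳ-< n₁ i<) j<
  cut : ∀ {c} → c ∈ R (n₁ + n₂) m → c ∈ R n₁ m ⊎ c ∈ translate (+ n₁ , + 0) (R n₂ m)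
  cut c∈ with ∈-R⁻ (n₁ + n₂) m c∈
  ... | i , j , i< , j< , refl with <⊎≥ i n₁ i<
  ... | inj₁ i<n₁           = inj₁ (∈-R⁺ i<n₁ j<)
  ... | inj₂ (o , o< , refl) = inj₂ (∈-map⁺ _ (∈-R⁺ o< j<))
  disjoint : Disjoint (R n₁ m) (translate (+ n₁ , + 0) (R n₂ m))
  disjoint (c∈t , c∈b) with ∈-map⁻ _ c∈b
  ... | _ , d∈ , refl with ∈-R⁻ n₂ m d∈
  ... | i , j , i< , j< , refl with ∈-R⁻ n₁ m c∈t
  ... | _ , _ , i<n₁ , _ , refl = ℕ.m+n≮m n₁ i i<n₁

-- Degenerate rectangles start the inductions that build grids, and form the first alternative of
-- `Criterion`.
empty-tiling : ∀ {n m} → n ≡ 0 ⊎ m ≡ 0 → IsTiling n m []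
empty-tiling {n} {m} z = record { inside = [] ; covers = λ c∈ → contradiction c∈ (∉R z) ; nonoverlap = [] }
  where
  ∉R : n ≡ 0 ⊎ m ≡ 0 → ∀ {c} → c ∈ R n m → ⊥
  ∉R z c∈ with ∈-R⁻ n m c∈
  ∉R (inj₁ refl) _ | _ , _ , () , _
  ∉R (inj₂ refl) _ | _ , _ , _ , () , _

rectangle-tiling : ∀ h w .{{_ : NonZero h}} .{{_ : NonZero w}} → IsTiling h w ((rectangle h w , 0ᵥ) ∷ [])
rectangle-tiling h w = record
  { inside     = subst (_⊆ R h w) (sym (translate-0 (R h w))) id ∷ []
  ; covers     = λ c∈ → here (subst (_ ∈_) (sym (translate-0 (R h w))) c∈)
  ; nonoverlap = [] ∷ []
  }

-- Least bounds and transport along permutations.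

least-bound : {P : ℕ → Set} → Decidable P → ∀ B → (∀ m → B < m → P m) →
  ∃ λ β → (∀ m → β < m → P m) × (∀ k → (∀ m → k < m → P m) → β ≤ k)
least-bound P? zero    beyond = 0 , beyond , λ _ _ → ℕ.z≤n
least-bound {P} P? (suc B) beyond with P? (suc B)
-- The first failure met from above is the least bound: any smaller `k` would promise `P (suc B)`.
... | no ¬p = suc B , beyond , λ k beyond-k → ℕ.≮⇒≥ (λ k<1+B → ¬p (beyond-k (suc B) k<1+B))
... | yes p = least-bound P? B λ m B<m → [ beyond m , (λ { refl → p }) ]′ (ℕ.m≤n⇒m<n∨m≡n B<m)

All-resp-Permutation : ∀ {P : Polyomino → Set} {_∼_ : Polyomino → Polyomino → Set} →
  (∀ {p q} → p ∼ q → P p → P q) → ∀ {ps qs} → Permutation _∼_ ps qs → All P ps → All P qs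
All-resp-Permutation {P} {_∼_} resp = go
  where
  pointwise : ∀ {ps qs} → Pointwise _∼_ ps qs → All P ps → All P qs
  pointwise []       []       = []
  pointwise (e ∷ es) (p ∷ ps) = resp e p ∷ pointwise es ps
  go : ∀ {ps qs} → Permutation _∼_ ps qs → All P ps → All P qs
  go (Homogeneous.refl es)     ps           = pointwise es ps
  go (Homogeneous.prep e π)    (p ∷ ps)     = resp e p ∷ go π ps
  go (Homogeneous.swap e f π)  (p ∷ q ∷ ps) = resp f q ∷ resp e p ∷ go π ps
  go (Homogeneous.trans π ρ)   ps           = go ρ (go π ps)

-- Tilings as lists of boxes.

module _ (a b : ℕ) .{{_ : NonZero a}} .{{_ : NonZero b}} where

  -- A normal form for `Copies`: up to translation, all rotations and reflections come down to two
  -- orientations. For `a = b` the two constructors overlap, which is harmless.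
  data Tile (q : Polyomino) : Set where
    upright : rectangle a b ≈ q → Tile q
    turned  : rectangle b a ≈ q → Tile q

  -- The cell list of a polyomino may repeat cells in any order. A corner and an orientation
  -- determine a canonical list without repetitions, over which cells can be summed.
  box : Cell ⊎ Cell → List Cell
  box (inj₁ v) = translate v (R a b)
  box (inj₂ v) = translate v (R b a)

  box-unique : ∀ β → Unique (box β)
  box-unique (inj₁ v) = Unique.map⁺ (+ᵥ-cancelˡ v) (R-unique a b)
  box-unique (inj₂ v) = Unique.map⁺ (+ᵥ-cancelˡ v) (R-unique b a)

  footprint-box : ∀ ((q , v) : Placement) → Tile q → ∃ λ β → box β ∼[ set ] footprint (q , v)
  footprint-box (q , v) (upright (u , e)) = inj₁ (v +ᵥ u) ,
    ⇔.trans (∼-reflexive (sym (translate-translate v u (R a b)))) (translate-cong v e)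
  footprint-box (q , v) (turned (u , e)) = inj₂ (v +ᵥ u) ,
    ⇔.trans (∼-reflexive (sym (translate-translate v u (R b a)))) (translate-cong v e)

  -- Each box is free of repetitions, and disjointness of the footprints keeps their concatenation
  -- so.
  boxes : ∀ τ → All Tile (shapes τ) → AllPairs (λ s t → Disjoint (footprint s) (footprint t)) τ →
    ∃ λ βs → length βs ≡ length τ × Unique (concatMap box βs) ×
             concatMap box βs ∼[ set ] concatMap footprint τ
  boxes []      []          []          = [] , refl , [] , ⇔.refl
  boxes (t ∷ τ) (tile ∷ tiles) (t#τ ∷ disj) with footprint-box t tile | boxes τ tiles disj
  ... | β , β∼t | βs , len , unique , βs∼τ =
    β ∷ βs , cong suc len , Unique.++⁺ (box-unique β) unique disjoint , BagSet.++-cong β∼t βs∼τ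
    where
    disjoint : Disjoint (box β) (concatMap box βs)
    disjoint (c∈β , c∈βs) =
      All.All¬⇒¬Any (All.map (λ # c∈s → # (Equivalence.to β∼t c∈β , c∈s)) t#τ)
        (∈-concatMap⁻ footprint (Equivalence.to βs∼τ c∈βs))

  -- Two lists without repetitions that have the same elements are permutations of each other. Sums
  -- over the region can therefore be taken tile by tile.
  tiling-boxes : ∀ {n m τ} → IsTiling n m τ → All Tile (shapes τ) →
    ∃ λ βs → length βs ≡ length τ × R n m ↭ concatMap box βs
  tiling-boxes {n} {m} {τ} t tiles with boxes τ tiles (IsTiling.nonoverlap t)
  ... | βs , len , unique , βs∼τ = βs , len ,
    ∼bag⇒↭ (unique∧set⇒bag (R-unique n m) unique (⇔.trans R∼τ (⇔.sym βs∼τ)))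
    where
    open IsTiling t
    R∼τ : R n m ∼[ set ] concatMap footprint τ
    R∼τ = mk⇔ (∈-concatMap⁺ footprint ∘ covers)
              (λ c∈ → All.lookupWith (λ s⊆R c∈s → s⊆R c∈s) inside (∈-concatMap⁻ footprint c∈))

  -- Additivity of measures.

  measure : (F G : ℤ → ℤ) → Cell ⊎ Cell → ℤ
  measure F G (inj₁ v) = boxMeasure F G v a b
  measure F G (inj₂ v) = boxMeasure F G v b a

  -- The whole region is itself a box with corner `0ᵥ`, so both sides add up the same cell weights.
  measure-additive : ∀ (F G : ℤ → ℤ) n m βs → R n m ↭ concatMap box βs →
    (F (+ n) ℤ.- F 0ℤ) ℤ.* (G (+ m) ℤ.- G 0ℤ) ≡ ∑ (measure F G) βs
  measure-additive F G n m βs R↭βs = begin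
    (F (+ n) ℤ.- F 0ℤ) ℤ.* (G (+ m) ℤ.- G 0ℤ) ≡⟨⟩
    boxMeasure F G 0ᵥ n m               ≡⟨ ∑-box F G 0ᵥ n m ⟨
    ∑ f (translate 0ᵥ (R n m))          ≡⟨ cong (∑ f) (translate-0 (R n m)) ⟩
    ∑ f (R n m)                         ≡⟨ ∑-↭ f R↭βs ⟩
    ∑ f (concatMap box βs)              ≡⟨ ∑-concatMap f box βs ⟩
    ∑ (∑ f ∘ box) βs                    ≡⟨ ∑-cong weight βs ⟩
    ∑ (measure F G) βs                  ∎
    where
    open ≡-Reasoning
    f = λ (i , j) → increment F i ℤ.* increment G j
    weight : ∀ β → ∑ f (box β) ≡ measure F G β
    weight (inj₁ v) = ∑-box F G v a b
    weight (inj₂ v) = ∑-box F G v b a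

  -- Congruent copies of the rectangle.

  tile-≈ : ∀ p q → Tile p → p ≈ q → Tile q
  tile-≈ p q (upright e) f = upright (≈-trans (rectangle a b) p q e f)
  tile-≈ p q (turned e)  f = turned (≈-trans (rectangle b a) p q e f)

  rotate-≈ : ∀ h w .{{_ : NonZero h}} .{{_ : NonZero w}} p → rectangle h w ≈ p → rectangle w h ≈ rotate p
  rotate-≈ h w p e = ≈-trans (rectangle w h) (rotate (rectangle h w)) (rotate p)
    (≈-sym (rotate (rectangle h w)) (rectangle w h) (rotate-rectangle h w)) (rotate-cong (rectangle h w) p e)

  tile-rotate : ∀ {p} → Tile p → Tile (rotate p)
  tile-rotate {p} (upright e) = turned (rotate-≈ a b p e)
  tile-rotate {p} (turned e)  = upright (rotate-≈ b a p e)

  tile-rotatedCopy : ∀ {p q} → RotatedCopy p q → Tile p → Tile q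
  tile-rotatedCopy {p} {q} (k , e) tile = tile-≈ (fold p rotate k) q (rotations k) e
    where
    rotations : ∀ k → Tile (fold p rotate k)
    rotations zero    = tile
    rotations (suc k) = tile-rotate (rotations k)

  -- Reflecting the rectangle only translates it, and each quarter turn exchanges the two
  -- orientations.
  copy⇒tile : ∀ {q} → Copies ｛ rectangle a b ｝ q → Tile q
  copy⇒tile {q} (p , refl , inj₁ r) = tile-rotatedCopy {p} {q} r (upright (≈-refl p))
  copy⇒tile {q} (p , refl , inj₂ r) = tile-rotatedCopy {reflect p} {q} r
    (upright (≈-sym (reflect p) p (reflect-rectangle a b)))

  tiles-rotatedCopies : ∀ {p q} → Tile p → Tile q → RotatedCopy p q
  tiles-rotatedCopies {p} {q} = go
    where
    equal : ∀ r → r ≈ p → r ≈ q → RotatedCopy p q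
    equal r e f = 0 , ≈-trans p r q (≈-sym r p e) f
    rotated : ∀ r → r ≈ rotate p → r ≈ q → RotatedCopy p q
    rotated r e f = 1 , ≈-trans (rotate p) r q (≈-sym r (rotate p) e) f
    go : Tile p → Tile q → RotatedCopy p q
    go (upright e) (upright f) = equal (rectangle a b) e f
    go (turned e)  (turned f)  = equal (rectangle b a) e f
    go (upright e) (turned f)  = rotated (rectangle b a) (rotate-≈ a b p e) f
    go (turned e)  (upright f) = rotated (rectangle a b) (rotate-≈ b a p e) f

  tile⇒copy : ∀ {q} → Tile q → Copies ｛ rectangle a b ｝ q
  tile⇒copy tile = rectangle a b , refl , inj₁ (tiles-rotatedCopies (upright (≈-refl (rectangle a b))) tile)

  tiles-pointwise : ∀ {ps qs} → All Tile ps → All Tile qs → length ps ≡ length qs →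
                    Pointwise RotatedCopy ps qs
  tiles-pointwise []       []       _   = []
  tiles-pointwise (p ∷ ps) (q ∷ qs) len =
    tiles-rotatedCopies p q ∷ tiles-pointwise ps qs (ℕ.suc-injective len)

  -- Necessary conditions for a tiling.

  area : ∀ {n m τ} → IsTiling n m τ → All Tile (shapes τ) → n * m ≡ length τ * (a * b)
  area {n} {m} {τ} t tiles with tiling-boxes t tiles
  ... | βs , len , R↭βs = ℤ.+-injective (begin
    + (n * m)                                     ≡⟨ ℤ.pos-* n m ⟩
    + n ℤ.* + m                                   ≡⟨ cong₂ ℤ._*_ (ℤ.+-identityʳ (+ n)) (ℤ.+-identityʳ (+ m)) ⟨
    (+ n ℤ.- 0ℤ) ℤ.* (+ m ℤ.- 0ℤ)                 ≡⟨ measure-additive id id n m βs R↭βs ⟩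
    ∑ (measure id id) βs                          ≡⟨ ∑-const tile-area βs ⟩
    + (length βs * (a * b))                       ≡⟨ cong (λ l → + (l * (a * b))) len ⟩
    + (length τ * (a * b))                        ∎)
    where
    open ≡-Reasoning
    box-area : ∀ v h w → boxMeasure id id v h w ≡ + (h * w)
    box-area (x , y) h w = trans (cong₂ ℤ._*_ (width x (+ h)) (width y (+ w))) (sym (ℤ.pos-* h w))
    tile-area : ∀ β → measure id id β ≡ + (a * b)
    tile-area (inj₁ v) = box-area v a b
    tile-area (inj₂ v) = trans (box-area v b a) (cong +_ (ℕ.*-comm b a))

  -- In either orientation a tile has one side divisible by `d`, so its measure vanishes. The
  -- product for the whole region is then 0, and one of its factors must be 0.
  ∣-height-or-width : ∀ {n m τ d} → IsTiling n m τ → All Tile (shapes τ) → d ∣ a ⊎ d ∣ b → d ∣ n ⊎ d ∣ m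
  ∣-height-or-width {n} {m} {τ} {d} t tiles d∣ with tiling-boxes t tiles
  ... | βs , _ , R↭βs =
    Sum.map (multipleOf-∣ d) (multipleOf-∣ d)
      (ℤ.i*j≡0⇒i≡0∨j≡0 (F (+ n) ℤ.- F 0ℤ)
        (trans (measure-additive F F n m βs R↭βs) (∑-zero (tile-zero d∣) βs)))
    where
    F = multipleOf d
    vanishes : ∀ x {h} → d ∣ h → F (x ℤ.+ + h) ℤ.- F x ≡ 0ℤ
    vanishes x d∣h = ℤ.i≡j⇒i-j≡0 (multipleOf-+ d x d∣h)
    height-zero : ∀ v {h} w → d ∣ h → boxMeasure F F v h w ≡ 0ℤ
    height-zero (x , y) w d∣h rewrite vanishes x d∣h = refl
    width-zero : ∀ v h {w} → d ∣ w → boxMeasure F F v h w ≡ 0ℤ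
    width-zero (x , y) h d∣w rewrite vanishes y d∣w = ℤ.*-zeroʳ (F (x ℤ.+ + h) ℤ.- F x)
    tile-zero : d ∣ a ⊎ d ∣ b → ∀ β → measure F F β ≡ 0ℤ
    tile-zero (inj₁ d∣a) (inj₁ v) = height-zero v b d∣a
    tile-zero (inj₁ d∣a) (inj₂ v) = width-zero v b d∣a
    tile-zero (inj₂ d∣b) (inj₁ v) = width-zero v a d∣b
    tile-zero (inj₂ d∣b) (inj₂ v) = height-zero v a d∣b

  Representable : ℕ → Set
  Representable k = ∃₂ λ x y → k ≡ x * a + y * b

  representable? : Decidable Representable
  representable? k = map′
    (λ (x , _ , y , _ , eq) → x , y , eq)
    (λ { (x , y , refl) → x , ℕ.s≤s (ℕ.≤-trans (ℕ.m≤m*n x a) (ℕ.m≤m+n (x * a) (y * b)))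
                        , y , ℕ.s≤s (ℕ.≤-trans (ℕ.m≤m*n y b) (ℕ.m≤n+m (y * b) (x * a))) , refl })
    -- As `a` and `b` are positive, neither coefficient can exceed `k`, so a search below `suc k` is
    -- exhaustive.
    (ℕ.anyUpTo? (λ x → ℕ.anyUpTo? (λ y → k ℕ.≟ x * a + y * b) (suc k)) (suc k))

  ∑-representable : ∀ {A : Set} {f : A → ℤ} → (∀ x → ∃ λ k → f x ≡ + k × Representable k) →
                    ∀ xs → ∃ λ k → ∑ f xs ≡ + k × Representable k
  ∑-representable rep []       = 0 , refl , 0 , 0 , refl
  ∑-representable rep (z ∷ zs) with rep z | ∑-representable rep zs
  ... | k , eq , x , y , refl | l , eqs , u , v , refl =
    k + l , cong₂ ℤ._+_ eq eqs , x + u , y + v , collect x y u v a b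
    where
    collect : ∀ x y u v a b → (x * a + y * b) + (u * a + v * b) ≡ (x + u) * a + (y + v) * b
    collect = ℕ.solve-∀

  multiple-of-a : ∀ k → Representable (k * a)
  multiple-of-a k = k , 0 , sym (ℕ.+-identityʳ (k * a))

  multiple-of-b : ∀ k → Representable (k * b)
  multiple-of-b k = 0 , k , refl

  -- The positive height `suc n` makes the increment of `step` across the region 1, so the region
  -- has measure `m`. A tile contributes a natural multiple of its width, which is `b` if upright
  -- and `a` if turned.
  width-representable : ∀ {n m τ} → IsTiling (suc n) m τ → All Tile (shapes τ) → Representable m
  width-representable {n} {m} t tiles with tiling-boxes t tiles
  ... | βs , _ , R↭βs with ∑-representable tile-row βs
    where
    row : ∀ v h w → (∀ k → Representable (k * w)) → ∃ λ k → boxMeasure step id v h w ≡ + k × Representable k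
    row (x , y) h w rep with step-mono x h
    ... | k , eq = k * w , trans (cong₂ ℤ._*_ eq (width y (+ w))) (sym (ℤ.pos-* k w)) , rep k
    tile-row : ∀ β → ∃ λ k → measure step id β ≡ + k × Representable k
    tile-row (inj₁ v) = row v a b multiple-of-b
    tile-row (inj₂ v) = row v b a multiple-of-a
  ... | k , eq , rep = subst Representable (ℤ.+-injective (begin
    + k                       ≡⟨ eq ⟨
    ∑ (measure step id) βs    ≡⟨ measure-additive step id (suc n) m βs R↭βs ⟨
    1ℤ ℤ.* (+ m ℤ.- 0ℤ)       ≡⟨ ℤ.*-identityˡ _ ⟩
    + m ℤ.- 0ℤ                ≡⟨ ℤ.+-identityʳ (+ m) ⟩
    + m                       ∎)) rep
    where open ≡-Reasoning

  height-representable : ∀ {n m τ} → IsTiling n (suc m) τ → All Tile (shapes τ) → Representable n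
  height-representable {n} {m} t tiles with tiling-boxes t tiles
  ... | βs , _ , R↭βs with ∑-representable tile-column βs
    where
    column : ∀ v h w → (∀ k → Representable (k * h)) → ∃ λ k → boxMeasure id step v h w ≡ + k × Representable k
    column (x , y) h w rep with step-mono y w
    ... | k , eq = k * h ,
      trans (cong₂ ℤ._*_ (width x (+ h)) eq) (trans (ℤ.*-comm (+ h) (+ k)) (sym (ℤ.pos-* k h))) , rep k
    tile-column : ∀ β → ∃ λ k → measure id step β ≡ + k × Representable k
    tile-column (inj₁ v) = column v a b multiple-of-a
    tile-column (inj₂ v) = column v b a multiple-of-b
  ... | k , eq , rep = subst Representable (ℤ.+-injective (begin
    + k                       ≡⟨ eq ⟨
    ∑ (measure id step) βs    ≡⟨ measure-additive id step n (suc m) βs R↭βs ⟨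
    (+ n ℤ.- 0ℤ) ℤ.* 1ℤ       ≡⟨ ℤ.*-identityʳ _ ⟩
    + n ℤ.- 0ℤ                ≡⟨ ℤ.+-identityʳ (+ n) ⟩
    + n                       ∎)) rep
    where open ≡-Reasoning

  -- A decidable criterion for tileability.

  Tileable : ℕ → ℕ → Set
  Tileable n m = ∃ λ τ → IsTiling n m τ × All Tile (shapes τ)

  -- The alternatives are the empty region, a grid of upright tiles, a grid of turned tiles, two
  -- grids side by side, and two grids stacked.
  Criterion : ℕ → ℕ → Set
  Criterion n m = (n ≡ 0 ⊎ m ≡ 0)
                ⊎ (a ∣ n × b ∣ m)
                ⊎ (b ∣ n × a ∣ m)
                ⊎ (a ∣ n × b ∣ n × Representable m)
                ⊎ (a ∣ m × b ∣ m × Representable n)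

  criterion? : ∀ n m → Dec (Criterion n m)
  criterion? n m = (n ℕ.≟ 0 ⊎-dec m ℕ.≟ 0)
             ⊎-dec (a ∣? n ×-dec b ∣? m)
             ⊎-dec (b ∣? n ×-dec a ∣? m)
             ⊎-dec (a ∣? n ×-dec b ∣? n ×-dec representable? m)
             ⊎-dec (a ∣? m ×-dec b ∣? m ×-dec representable? n)

  -- Each of `a` and `b` divides the height or the width. If they divide different sides, a grid
  -- fits; if the same side, the first row or column makes the other side representable.
  tileable⇒criterion : ∀ n m → Tileable n m → Criterion n m
  tileable⇒criterion zero    m       _ = inj₁ (inj₁ refl)
  tileable⇒criterion (suc n) zero    _ = inj₁ (inj₂ refl)
  tileable⇒criterion (suc n) (suc m) (τ , t , tiles)
    with ∣-height-or-width t tiles (inj₁ ℕ.∣-refl) | ∣-height-or-width t tiles (inj₂ ℕ.∣-refl)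
  ... | inj₁ a∣n | inj₂ b∣m = inj₂ (inj₁ (a∣n , b∣m))
  ... | inj₂ a∣m | inj₁ b∣n = inj₂ (inj₂ (inj₁ (b∣n , a∣m)))
  ... | inj₁ a∣n | inj₁ b∣n = inj₂ (inj₂ (inj₂ (inj₁ (a∣n , b∣n , width-representable t tiles))))
  ... | inj₂ a∣m | inj₂ b∣m = inj₂ (inj₂ (inj₂ (inj₂ (a∣m , b∣m , height-representable t tiles))))

  upright-tileable : Tileable a b
  upright-tileable = _ , rectangle-tiling a b , upright (≈-refl (rectangle a b)) ∷ []

  turned-tileable : Tileable b a
  turned-tileable = _ , rectangle-tiling b a , turned (≈-refl (rectangle b a)) ∷ []

  shifted-tiles : ∀ v τ₁ τ₂ → All Tile (shapes τ₁) → All Tile (shapes τ₂) →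
                  All Tile (shapes (τ₁ ++ map (shift v) τ₂))
  shifted-tiles v τ₁ τ₂ tiles₁ tiles₂ =
    subst (All Tile) (sym (shapes-++-shift v τ₁ τ₂)) (All.++⁺ tiles₁ tiles₂)

  juxtapose-tileable : ∀ {n m₁ m₂} → Tileable n m₁ → Tileable n m₂ → Tileable n (m₁ + m₂)
  juxtapose-tileable {m₁ = m₁} (τ₁ , t₁ , tiles₁) (τ₂ , t₂ , tiles₂) =
    _ , juxtapose-tiling t₁ t₂ , shifted-tiles (+ 0 , + m₁) τ₁ τ₂ tiles₁ tiles₂

  stack-tileable : ∀ {n₁ n₂ m} → Tileable n₁ m → Tileable n₂ m → Tileable (n₁ + n₂) m
  stack-tileable {n₁} (τ₁ , t₁ , tiles₁) (τ₂ , t₂ , tiles₂) =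
    _ , stack-tiling t₁ t₂ , shifted-tiles (+ n₁ , + 0) τ₁ τ₂ tiles₁ tiles₂

  grid-tileable : ∀ {h w n m} → Tileable h w → h ∣ n → w ∣ m → Tileable n m
  grid-tileable {h} {w} tile (ℕ.divides-refl q) (ℕ.divides-refl r) = rows q
    where
    columns : ∀ r → Tileable h (r * w)
    columns zero    = [] , empty-tiling (inj₂ refl) , []
    columns (suc r) = juxtapose-tileable tile (columns r)
    rows : ∀ q → Tileable (q * h) (r * w)
    rows zero    = [] , empty-tiling (inj₁ refl) , []
    rows (suc q) = stack-tileable (columns r) (rows q)

  criterion⇒tileable : ∀ n m → Criterion n m → Tileable n m
  criterion⇒tileable n m (inj₁ z) = [] , empty-tiling z , []
  criterion⇒tileable n m (inj₂ (inj₁ (a∣n , b∣m))) = grid-tileable upright-tileable a∣n b∣m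
  criterion⇒tileable n m (inj₂ (inj₂ (inj₁ (b∣n , a∣m)))) = grid-tileable turned-tileable b∣n a∣m
  criterion⇒tileable n m (inj₂ (inj₂ (inj₂ (inj₁ (a∣n , b∣n , x , y , refl))))) =
    -- Turned tiles fill the first `x * a` columns and upright ones the last `y * b`; both heights
    -- divide `n`.
    juxtapose-tileable (grid-tileable turned-tileable b∣n (ℕ.n∣m*n x))
                       (grid-tileable upright-tileable a∣n (ℕ.n∣m*n y))
  criterion⇒tileable n m (inj₂ (inj₂ (inj₂ (inj₂ (a∣m , b∣m , x , y , refl))))) =
    -- Upright tiles have height `a` and fill the first `x * a` rows; turned ones fill the other
    -- `y * b`.
    stack-tileable (grid-tileable upright-tileable (ℕ.n∣m*n x) b∣m)
                   (grid-tileable turned-tileable (ℕ.n∣m*n y) a∣m)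

  tileable? : ∀ n m → Dec (Tileable n m)
  tileable? n m = map′ (criterion⇒tileable n m) (tileable⇒criterion n m) (criterion? n m)

  -- Splitting tileable rectangles.

  Splits : ℕ → ℕ → Set
  Splits n m = ∃ λ d → d < m × d ≢ 0 × Tileable n d × Tileable n (m ∸ d)

  splits? : ∀ n m → Dec (Splits n m)
  splits? n m = ℕ.anyUpTo? (λ d → ¬? (d ℕ.≟ 0) ×-dec tileable? n d ×-dec tileable? n (m ∸ d)) m

  -- Every alternative of `Criterion` survives the removal of a suitable strip of width `a`, `b` or
  -- `a * b`. All three widths are at most `a * b`, so the rest is nonempty.
  wide⇒splits : ∀ n m → a * b < m → Criterion n m → Splits n m
  wide⇒splits n m ab<m = split
    where
    a<m : a < m
    a<m = ℕ.≤-<-trans (ℕ.m≤m*n a b) ab<m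
    b<m : b < m
    b<m = ℕ.≤-<-trans (ℕ.m≤n*m b a) ab<m
    splitOff : ∀ d → d ≢ 0 → d < m → Criterion n d → Criterion n (m ∸ d) → Splits n m
    splitOff d d≢0 d<m c c′ = d , d<m , d≢0 , criterion⇒tileable n d c , criterion⇒tileable n (m ∸ d) c′
    ∣-rest : ∀ {c d} → d < m → c ∣ d → c ∣ m → c ∣ m ∸ d
    ∣-rest d<m c∣d c∣m = ℕ.∣m+n∣m⇒∣n (subst (_ ∣_) (sym (ℕ.m+[n∸m]≡n (ℕ.<⇒≤ d<m))) c∣m) c∣d
    split : Criterion n m → Splits n m
    split (inj₁ (inj₁ n≡0)) =
      splitOff a (ℕ.≢-nonZero⁻¹ a) a<m (inj₁ (inj₁ n≡0)) (inj₁ (inj₁ n≡0))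
    split (inj₁ (inj₂ refl)) = contradiction ab<m ℕ.n≮0
    split (inj₂ (inj₁ (a∣n , b∣m))) =
      splitOff b (ℕ.≢-nonZero⁻¹ b) b<m
        (inj₂ (inj₁ (a∣n , ℕ.∣-refl)))
        (inj₂ (inj₁ (a∣n , ∣-rest b<m ℕ.∣-refl b∣m)))
    split (inj₂ (inj₂ (inj₁ (b∣n , a∣m)))) =
      splitOff a (ℕ.≢-nonZero⁻¹ a) a<m
        (inj₂ (inj₂ (inj₁ (b∣n , ℕ.∣-refl))))
        (inj₂ (inj₂ (inj₁ (b∣n , ∣-rest a<m ℕ.∣-refl a∣m))))
    -- Both coefficients being zero would make `m` zero.
    split (inj₂ (inj₂ (inj₂ (inj₁ (a∣n , b∣n , zero , zero , refl))))) = contradiction ab<m ℕ.n≮0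
    split (inj₂ (inj₂ (inj₂ (inj₁ (a∣n , b∣n , suc x , y , refl))))) =
      splitOff a (ℕ.≢-nonZero⁻¹ a) a<m
        (strips (subst Representable (ℕ.*-identityˡ a) (multiple-of-a 1)))
        (strips (x , y , trans (cong (_∸ a) (ℕ.+-assoc a (x * a) (y * b))) (ℕ.m+n∸m≡n a _)))
      where
      strips : ∀ {k} → Representable k → Criterion n k
      strips rep = inj₂ (inj₂ (inj₂ (inj₁ (a∣n , b∣n , rep))))
    split (inj₂ (inj₂ (inj₂ (inj₁ (a∣n , b∣n , zero , suc y , refl))))) =
      splitOff b (ℕ.≢-nonZero⁻¹ b) b<m
        (strips (subst Representable (ℕ.*-identityˡ b) (multiple-of-b 1)))
        (strips (0 , y , ℕ.m+n∸m≡n b _))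
      where
      strips : ∀ {k} → Representable k → Criterion n k
      strips rep = inj₂ (inj₂ (inj₂ (inj₁ (a∣n , b∣n , rep))))
    split (inj₂ (inj₂ (inj₂ (inj₂ (a∣m , b∣m , rep))))) =
      -- A common multiple of `a` and `b` is removed, so both still divide the remaining width; the
      -- condition on the height is unchanged.
      splitOff (a * b) (ℕ.≢-nonZero⁻¹ (a * b) {{ℕ.m*n≢0 a b}}) ab<m
        (inj₂ (inj₂ (inj₂ (inj₂ (ℕ.m∣m*n b , ℕ.n∣m*n a , rep)))))
        (inj₂ (inj₂ (inj₂ (inj₂ (∣-rest ab<m (ℕ.m∣m*n b) a∣m , ∣-rest ab<m (ℕ.n∣m*n a) b∣m , rep)))))

  -- Any tilings of the two parts will do: the area fixes the number of tiles, and tilings with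
  -- equally many tiles are rearrangements of each other.
  splits⇒admitsSubtiling : ∀ {n m τ} → IsTiling n m τ → All Tile (shapes τ) →
                           Splits n m → AdmitsSubtiling n m τ
  splits⇒admitsSubtiling {n} {m} {τ} t tiles
    (d , d<m , d≢0 , (τ₁ , t₁ , tiles₁) , (τ₂ , t₂ , tiles₂)) = record
    { m≡m′+m″       = m≡d+rest
    ; m′≢0          = d≢0
    ; m″≢0          = ℕ.m<n⇒n≢0 (ℕ.m<n⇒0<n∸m d<m)
    ; tiling₁       = t₁
    ; tiling₂       = t₂
    ; rearrangement = record
      { isTiling = t′
      ; rotated  = Homogeneous.refl (tiles-pointwise tiles tiles′ equinumerous)
      }
    }
    where
    m≡d+rest = sym (ℕ.m+[n∸m]≡n (ℕ.<⇒≤ d<m))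
    τ′ = juxtapose d τ₁ τ₂
    t′ : IsTiling n m τ′
    t′ = subst (λ k → IsTiling n k τ′) (sym m≡d+rest) (juxtapose-tiling t₁ t₂)
    tiles′ : All Tile (shapes τ′)
    tiles′ = shifted-tiles (+ 0 , + d) τ₁ τ₂ tiles₁ tiles₂
    equinumerous : length (shapes τ) ≡ length (shapes τ′)
    equinumerous = trans (length-map proj₁ τ) (trans
      (ℕ.*-cancelʳ-≡ _ _ (a * b) {{ℕ.m*n≢0 a b}} (trans (sym (area t tiles)) (area t′ tiles′)))
      (sym (length-map proj₁ τ′)))

  -- Rotated copies of tiles are tiles, so both parts are tiled by tiles. This converse is what
  -- minimality of the bound rests on.
  admitsSubtiling⇒splits : ∀ {n m τ} → All Tile (shapes τ) → AdmitsSubtiling n m τ → Splits n m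
  admitsSubtiling⇒splits {n} {m} tiles s =
    m′ , subst (m′ <_) (sym m≡m′+m″) (ℕ.m<m+n m′ (ℕ.n≢0⇒n>0 m″≢0)) , m′≢0 ,
    (τ₁ , tiling₁ , All.++⁻ˡ (shapes τ₁) tiles′) ,
    subst (Tileable n) (sym (trans (cong (_∸ m′) m≡m′+m″) (ℕ.m+n∸m≡n m′ m″)))
      (τ₂ , tiling₂ , All.++⁻ʳ (shapes τ₁) tiles′)
    where
    open AdmitsSubtiling s
    tiles′ : All Tile (shapes τ₁ ++ shapes τ₂)
    tiles′ = subst (All Tile) (shapes-++-shift (+ 0 , + m′) τ₁ τ₂)
      (All-resp-Permutation tile-rotatedCopy (IsRearrangement.rotated rearrangement) tiles)

theorem2p8 : (a b : ℕ) .{{_ : NonZero a}} .{{_ : NonZero b}} → ∀ n → Noetherian n (Copies ｛ rectangle a b ｝)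
-- `SubtilingsBeyond` speaks of all tilings, but whether a subtiling exists depends on `n` and `m`
-- alone. This reduces it to a decidable implication for each `m`, which holds beyond `a * b`.
theorem2p8 a b n with least-bound (λ m → tileable? a b n m →-dec splits? a b n m) (a * b)
                        (λ m ab<m t → wide⇒splits a b n m ab<m (tileable⇒criterion a b n m t))
... | β , beyond , least = β , record
  { bound = λ m β<m τ t copies → let tiles = All.map (copy⇒tile a b) copies in
      splits⇒admitsSubtiling a b t tiles (beyond m β<m (τ , t , tiles))
  ; least = λ k bound → least k λ m k<m (τ , t , tiles) →
      admitsSubtiling⇒splits a b tiles (bound m k<m τ t (All.map (tile⇒copy a b) tiles))
  }
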